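{- Let $G$ be an affine game. Then: $G>0$ if and only if $G\in\mathcal L$; $G=0$ if and only if $G\in\mathcal P$; $G\,\|\,0$ if and only if $G\in\mathcal N$; $G<0$ if and only if $G\in\mathcal R$.
   Context: Affine games are defined recursively. There are two games without options, denoted $\infty$ and $\overline{\infty}$ (terminating games). Every other affine game is a form $G=\{G^{\mathcal L}\mid G^{\mathcal R}\}$, where $G^{\mathcal L}$ (Left options) and $G^{\mathcal R}$ (Right options) are non-empty finite sets of previously constructed affine games. Let $\mathbb A$ be the set of all affine games. The game $0$ is $\{\overline\infty\mid\infty\}$. Disjunctive sum: $G+H$ is undefined if one of $G,H$ is the form $\infty$ and the other is $\overline\infty$; it is $\infty$ if one is $\infty$ and the other is not $\overline\infty$; it is $\overline\infty$ if one is $\overline\infty$ and the other is not $\infty$; otherwise $G+H=\{G^{\mathcal L}+H,\,G+H^{\mathcal L}\mid G^{\mathcal R}+H,\,G+H^{\mathcal R}\}$. Outcomes: $o^L(G)=\mathbf L$ if $G=\infty$ or some $G^L\in G^{\mathcal L}$ has $o^R(G^L)=\mathbf L$, and $o^L(G)=\mathbf R$ otherwise; $o^R(G)=\mathbf R$ if $G=\overline\infty$ or some $G^R\in G^{\mathcal R}$ has $o^L(G^R)=\mathbf R$, and $o^R(G)=\mathbf L$ otherwise. With $\mathbf L>\mathbf R$, the outcome is $o(G)=(o^L(G),o^R(G))$, ordered componentwise. $\mathcal L,\mathcal N,\mathcal P,\mathcal R$ are the classes of games with outcome $(\mathbf L,\mathbf L)$, $(\mathbf L,\mathbf R)$, $(\mathbf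 R,\mathbf L)$, $(\mathbf R,\mathbf R)$, respectively. Order and equality: $G\geqslant H$ iff $o(G+X)\geqslant o(H+X)$ for all $X\in\mathbb A\setminus\{\infty,\overline\infty\}$; $G=H$ (equality of games, not identity of forms) iff $o(G+X)=o(H+X)$ for all such $X$; $G>H$ means $G\geqslant H$ and $G\neq H$; $G<H$ means $H>G$; $G\,\|\,H$ means neither $G\geqslant H$ nor $H\geqslant G$. -}

module Defs where

open import Data.Bool using (if_then_else_)
open import Data.Empty using (⊥-elim-irr)
open import Data.Fin.Properties using (any?)
open import Data.Nat using (suc)
open import Data.Product using (_×_; _,_)
open import Data.Product.Relation.Binary.Pointwise.NonDependent using (Pointwise)
open import Data.Vec.Functional using (Vector; []; _∷_; _++_)
open import Level using (0ℓ)
open import Relation.Binary using (Rel; DecidableEquality)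
open import Relation.Binary.PropositionalEquality using (_≡_; _≢_; refl)
open import Relation.Nullary using (¬_; yes; no; does)
open import Relation.Unary using (Pred)

infix  4 _≥ᵂ_ _≥ᴼ_ _⩾_ _≈_ _>_ _<_ _∥_
infixl 6 _+_[_]

-- The non-empty finite sets of options are given as non-empty finite families;
-- the order and multiplicity of options have no effect on outcomes.
data Game : Set where
  ∞     : Game
  ∞̄     : Game
  ⟨_∣_⟩ : ∀ {m n} → Vector Game (suc m) → Vector Game (suc n) → Game

𝟘 : Game
𝟘 = ⟨ ∞̄ ∷ [] ∣ ∞ ∷ [] ⟩

NonTerminating : Pred Game 0ℓ
NonTerminating X = X ≢ ∞ × X ≢ ∞̄

data Clash : Rel Game 0ℓ where
  ∞-∞̄ : Clash ∞ ∞̄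
  ∞̄-∞ : Clash ∞̄ ∞

-- Disjunctive sum is partial: it takes a proof that it is defined. That proof is
-- irrelevant, so the value of a sum does not depend on it.
_+_[_] : (G H : Game) → .(¬ Clash G H) → Game
∞               + ∞̄               [ d ] = ⊥-elim-irr (d ∞-∞̄)
∞̄               + ∞               [ d ] = ⊥-elim-irr (d ∞̄-∞)
∞               + _               [ _ ] = ∞
_               + ∞               [ _ ] = ∞
∞̄               + _               [ _ ] = ∞̄
_               + ∞̄               [ _ ] = ∞̄
G@(⟨ Gᴸ ∣ Gᴿ ⟩) + H@(⟨ Hᴸ ∣ Hᴿ ⟩) [ _ ] =
  ⟨ (λ i → Gᴸ i + H [ (λ ()) ]) ++ (λ j → G + Hᴸ j [ (λ ()) ])
  ∣ (λ i → Gᴿ i + H [ (λ ()) ]) ++ (λ j → G + Hᴿ j [ (λ ()) ])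
  ⟩

defined : ∀ {G X} → NonTerminating X → ¬ Clash G X
defined (_ , X≢∞̄) ∞-∞̄ = X≢∞̄ refl
defined (X≢∞ , _) ∞̄-∞ = X≢∞ refl

data Winner : Set where
  𝐋 𝐑 : Winner

_≟ᵂ_ : DecidableEquality Winner
𝐋 ≟ᵂ 𝐋 = yes refl
𝐋 ≟ᵂ 𝐑 = no λ ()
𝐑 ≟ᵂ 𝐋 = no λ ()
𝐑 ≟ᵂ 𝐑 = yes refl

data _≥ᵂ_ : Rel Winner 0ℓ where
  ≥-refl : ∀ {w} → w ≥ᵂ w
  𝐋≥𝐑    : 𝐋 ≥ᵂ 𝐑

Outcome : Set
Outcome = Winner × Winner

_≥ᴼ_ : Rel Outcome 0ℓ
_≥ᴼ_ = Pointwise _≥ᵂ_ _≥ᵂ_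

oᴸ oᴿ : Game → Winner

oᴸ ∞          = 𝐋
oᴸ ∞̄          = 𝐑
oᴸ ⟨ Gᴸ ∣ _ ⟩ = if does (any? λ i → oᴿ (Gᴸ i) ≟ᵂ 𝐋) then 𝐋 else 𝐑

oᴿ ∞          = 𝐋
oᴿ ∞̄          = 𝐑
oᴿ ⟨ _ ∣ Gᴿ ⟩ = if does (any? λ i → oᴸ (Gᴿ i) ≟ᵂ 𝐑) then 𝐑 else 𝐋

o : Game → Outcome
o G = oᴸ G , oᴿ G

ℒ 𝒩 𝒫 ℛ : Pred Game 0ℓ
ℒ G = o G ≡ (𝐋 , 𝐋)
𝒩 G = o G ≡ (𝐋 , 𝐑)
𝒫 G = o G ≡ (𝐑 , 𝐋)
ℛ G = o G ≡ (𝐑 , 𝐑)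

_⩾_ _≈_ _>_ _<_ _∥_ : Rel Game 0ℓ
G ⩾ H = ∀ X (nt : NonTerminating X) → o (G + X [ defined nt ]) ≥ᴼ o (H + X [ defined nt ])
G ≈ H = ∀ X (nt : NonTerminating X) → o (G + X [ defined nt ]) ≡ o (H + X [ defined nt ])
G > H = G ⩾ H × ¬ (G ≈ H)
G < H = H > G
G ∥ H = ¬ (G ⩾ H) × ¬ (H ⩾ G)

{-# OPTIONS --safe #-}
-- The player who wins G moving second does not lose anything when G is added to X:
-- they follow their strategy for X and answer every move in G inside G. As 𝟘 is won
-- by whoever moves second, it is neutral for outcomes. Hence G ⩾ 𝟘 amounts to Left
-- winning G moving second, and 𝟘 ⩾ G to Right winning G moving second.
module Submission where

open import Defs
open import Data.Bool using (if_then_else_)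
open import Data.Empty using (⊥-elim-irr)
open import Data.Fin using (splitAt; _↑ˡ_; _↑ʳ_)
open import Data.Fin.Properties using (any?)
open import Data.Nat using (suc)
open import Data.Product using (_×_; _,_; ∃; proj₁; proj₂)
open import Data.Product.Properties using (,-injectiveˡ; ,-injectiveʳ)
open import Data.Sum using (inj₁; inj₂)
open import Data.Vec.Functional using (Vector)
open import Data.Vec.Functional.Properties using (lookup-++ˡ; lookup-++ʳ)
open import Function.Bundles using (_⇔_; mk⇔)
open import Relation.Binary.PropositionalEquality
  using (_≡_; _≢_; refl; sym; trans; cong; cong₂; subst; ≢-sym)
open import Relation.Nullary using (¬_; Dec; does; contradiction)
open import Relation.Nullary.Decidable using (dec-true; dec-false; decidable-stable)
open import Relation.Unary using (_∈_)

-- Players, moves and winning strategies.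

opponent : Winner → Winner
opponent 𝐋 = 𝐑
opponent 𝐑 = 𝐋

won : Winner → Game
won 𝐋 = ∞
won 𝐑 = ∞̄

winner : (mover : Winner) → Game → Winner
winner 𝐋 = oᴸ
winner 𝐑 = oᴿ

𝐋≢𝐑 : 𝐋 ≢ 𝐑
𝐋≢𝐑 ()

≢𝐑⇒≡𝐋 : ∀ {w} → w ≢ 𝐑 → w ≡ 𝐋
≢𝐑⇒≡𝐋 {𝐋} _   = refl
≢𝐑⇒≡𝐋 {𝐑} w≢𝐑 = contradiction refl w≢𝐑

≢𝐋⇒≡𝐑 : ∀ {w} → w ≢ 𝐋 → w ≡ 𝐑
≢𝐋⇒≡𝐑 {𝐋} w≢𝐋 = contradiction refl w≢𝐋
≢𝐋⇒≡𝐑 {𝐑} _   = refl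

data Move : Winner → Game → Game → Set where
  left  : ∀ {m n} {Gᴸ : Vector Game _} {Gᴿ : Vector Game _} i → Move 𝐋 (⟨_∣_⟩ {m} {n} Gᴸ Gᴿ) (Gᴸ i)
  right : ∀ {m n} {Gᴸ : Vector Game _} {Gᴿ : Vector Game _} i → Move 𝐑 (⟨_∣_⟩ {m} {n} Gᴸ Gᴿ) (Gᴿ i)

mutual
  -- Strategies as trees, indexed by the player so that Left and Right share their definition and
  -- most statements. `already` is needed because a terminating game has a winner but no moves.
  data WinsFirst (w : Winner) (G : Game) : Set where
    already : G ≡ won w → WinsFirst w G
    move    : ∀ {G′} → Move w G G′ → WinsSecond w G′ → WinsFirst w G

  -- The inequality excludes the terminating game won by the opponent, in which every move would be
  -- answered vacuously.
  data WinsSecond (w : Winner) (G : Game) : Set where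
    reply : G ≢ won (opponent w) →
            (∀ {G′} → Move (opponent w) G G′ → WinsFirst w G′) → WinsSecond w G

-- Strategies and outcomes determine each other.

module _ {a b} {A : Set a} {B : Set b} {x y : B} where

  if-true : (A? : Dec A) → A → (if does A? then x else y) ≡ x
  if-true A? p = cong (if_then x else y) (dec-true A? p)

  if-false : (A? : Dec A) → ¬ A → (if does A? then x else y) ≡ y
  if-false A? ¬p = cong (if_then x else y) (dec-false A? ¬p)

  if-true⁻¹ : (A? : Dec A) → x ≢ y → (if does A? then x else y) ≡ x → A
  if-true⁻¹ A? x≢y eq = decidable-stable A? λ ¬p → x≢y (trans (sym eq) (if-false A? ¬p))

  if-false⁻¹ : (A? : Dec A) → x ≢ y → (if does A? then x else y) ≡ y → ¬ A
  if-false⁻¹ A? x≢y eq p = x≢y (trans (sym (if-true A? p)) eq)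

-- The same decision procedure as inside `oᴸ`, so that the lemmas on `if` apply to outcomes
-- definitionally.
𝐋-option? : ∀ {n} (Gs : Vector Game n) → Dec (∃ λ i → oᴿ (Gs i) ≡ 𝐋)
𝐋-option? Gs = any? λ i → oᴿ (Gs i) ≟ᵂ 𝐋

𝐑-option? : ∀ {n} (Gs : Vector Game n) → Dec (∃ λ i → oᴸ (Gs i) ≡ 𝐑)
𝐑-option? Gs = any? λ i → oᴸ (Gs i) ≟ᵂ 𝐑

mutual
  winsFirst⇒winner : ∀ {w G} → WinsFirst w G → winner w G ≡ w
  winsFirst⇒winner {𝐋} (already refl) = refl
  winsFirst⇒winner {𝐑} (already refl) = refl
  winsFirst⇒winner {𝐋} (move (left {Gᴸ = Gᴸ} i) s) =
    if-true (𝐋-option? Gᴸ) (i , winsSecond⇒winner s)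
  winsFirst⇒winner {𝐑} (move (right {Gᴿ = Gᴿ} i) s) =
    if-true (𝐑-option? Gᴿ) (i , winsSecond⇒winner s)

  winsSecond⇒winner : ∀ {w G} → WinsSecond w G → winner (opponent w) G ≡ w
  winsSecond⇒winner {𝐋} {∞} _ = refl
  winsSecond⇒winner {𝐋} {∞̄} (reply G≢ _) = contradiction refl G≢
  winsSecond⇒winner {𝐋} {⟨ _ ∣ Gᴿ ⟩} (reply _ f) = if-false (𝐑-option? Gᴿ)
    -- An option good for Right would, by the strategy, also be won by Left moving first there.
    λ (i , p) → 𝐋≢𝐑 (trans (sym (winsFirst⇒winner (f (right i)))) p)
  winsSecond⇒winner {𝐑} {∞} (reply G≢ _) = contradiction refl G≢
  winsSecond⇒winner {𝐑} {∞̄} _ = refl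
  winsSecond⇒winner {𝐑} {⟨ Gᴸ ∣ _ ⟩} (reply _ f) = if-false (𝐋-option? Gᴸ)
    λ (i , p) → 𝐋≢𝐑 (trans (sym p) (winsFirst⇒winner (f (left i))))

mutual
  winner⇒winsFirst : ∀ w G → winner w G ≡ w → WinsFirst w G
  winner⇒winsFirst 𝐋 ∞ _ = already refl
  winner⇒winsFirst 𝐋 ⟨ Gᴸ ∣ _ ⟩ p =
    let i , q = if-true⁻¹ (𝐋-option? Gᴸ) 𝐋≢𝐑 p in move (left i) (winner⇒winsSecond 𝐋 (Gᴸ i) q)
  winner⇒winsFirst 𝐑 ∞̄ _ = already refl
  winner⇒winsFirst 𝐑 ⟨ _ ∣ Gᴿ ⟩ p =
    let i , q = if-true⁻¹ (𝐑-option? Gᴿ) (≢-sym 𝐋≢𝐑) p in move (right i) (winner⇒winsSecond 𝐑 (Gᴿ i) q)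

  -- The opponent's search for a winning option failed, and there are only two players, so `w` wins
  -- moving first after each of the opponent's moves.
  winner⇒winsSecond : ∀ w G → winner (opponent w) G ≡ w → WinsSecond w G
  winner⇒winsSecond 𝐋 ∞ _ = reply (λ ()) λ ()
  winner⇒winsSecond 𝐋 ⟨ _ ∣ Gᴿ ⟩ p = reply (λ ()) λ where
    (right i) → winner⇒winsFirst 𝐋 (Gᴿ i)
      (≢𝐑⇒≡𝐋 λ q → if-false⁻¹ (𝐑-option? Gᴿ) (≢-sym 𝐋≢𝐑) p (i , q))
  winner⇒winsSecond 𝐑 ∞̄ _ = reply (λ ()) λ ()
  winner⇒winsSecond 𝐑 ⟨ Gᴸ ∣ _ ⟩ p = reply (λ ()) λ where
    (left i) → winner⇒winsFirst 𝐑 (Gᴸ i)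
      (≢𝐋⇒≡𝐑 λ q → if-false⁻¹ (𝐋-option? Gᴸ) 𝐋≢𝐑 p (i , q))

-- Strategies in disjunctive sums.

won+ : ∀ w X .(d : ¬ Clash (won w) X) → X ≢ won (opponent w) → won w + X [ d ] ≡ won w
won+ 𝐋 ∞         _ _  = refl
won+ 𝐋 ∞̄         _ X≢ = contradiction refl X≢
won+ 𝐋 ⟨ _ ∣ _ ⟩ _ _  = refl
won+ 𝐑 ∞         _ X≢ = contradiction refl X≢
won+ 𝐑 ∞̄         _ _  = refl
won+ 𝐑 ⟨ _ ∣ _ ⟩ _ _  = refl

+won : ∀ w G .(d : ¬ Clash G (won w)) → G ≢ won (opponent w) → G + won w [ d ] ≡ won w
+won 𝐋 ∞         _ _  = refl
+won 𝐋 ∞̄         _ G≢ = contradiction refl G≢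
+won 𝐋 ⟨ _ ∣ _ ⟩ _ _  = refl
+won 𝐑 ∞         _ G≢ = contradiction refl G≢
+won 𝐑 ∞̄         _ _  = refl
+won 𝐑 ⟨ _ ∣ _ ⟩ _ _  = refl

-- In the cases without a clause the sum evaluates to another constructor, so the equation is
-- absurd.
+≢won : ∀ w G X .(d : ¬ Clash G X) → G ≢ won w → X ≢ won w → G + X [ d ] ≢ won w
+≢won 𝐋 ∞         X         _ G≢ _  _ = G≢ refl
+≢won 𝐋 ∞̄         ∞         _ _  X≢ _ = X≢ refl
+≢won 𝐋 ⟨ _ ∣ _ ⟩ ∞         _ _  X≢ _ = X≢ refl
+≢won 𝐑 ∞̄         X         _ G≢ _  _ = G≢ refl
+≢won 𝐑 ∞         ∞̄         _ _  X≢ _ = X≢ refl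
+≢won 𝐑 ⟨ _ ∣ _ ⟩ ∞̄         _ _  X≢ _ = X≢ refl

-- A view of the moves of a sum: matching on it replaces the resulting position by a sum with one
-- summand changed.
data MoveIn+ (w : Winner) (G X : Game) : Game → Set where
  inˡ : ∀ {G′} .(d : ¬ Clash G′ X) → Move w G G′ → MoveIn+ w G X (G′ + X [ d ])
  inʳ : ∀ {X′} .(d : ¬ Clash G X′) → Move w X X′ → MoveIn+ w G X (G + X′ [ d ])

move-in-+ : ∀ {w K} G X .(d : ¬ Clash G X) → Move w (G + X [ d ]) K → MoveIn+ w G X K
move-in-+ ∞         ∞         _ ()
move-in-+ ∞         ∞̄         d _ = ⊥-elim-irr (d ∞-∞̄)
move-in-+ ∞         ⟨ _ ∣ _ ⟩ _ ()
move-in-+ ∞̄         ∞         d _ = ⊥-elim-irr (d ∞̄-∞)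
move-in-+ ∞̄         ∞̄         _ ()
move-in-+ ∞̄         ⟨ _ ∣ _ ⟩ _ ()
-- `++` computes by `splitAt`, so splitting at the number of Left options of the first summand
-- reduces the option reached to a sum.
move-in-+ (⟨_∣_⟩ {m} _ _) ⟨ _ ∣ _ ⟩ _ (left i) with splitAt (suc m) i
... | inj₁ j = inˡ (λ ()) (left j)
... | inj₂ j = inʳ (λ ()) (left j)
move-in-+ (⟨_∣_⟩ {n = n} _ _) ⟨ _ ∣ _ ⟩ _ (right i) with splitAt (suc n) i
... | inj₁ j = inˡ (λ ()) (right j)
... | inj₂ j = inʳ (λ ()) (right j)

mutual
  -- `w` opens in the summand won moving first, which leaves two summands both won moving second.
  -- The mutual recursion ends because the strategies get smaller.
  winsFirst-+ˡ : ∀ {w} G X .(d : ¬ Clash G X) →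
                 WinsFirst w G → WinsSecond w X → WinsFirst w (G + X [ d ])
  winsFirst-+ˡ {w} _ X d (already refl) (reply X≢ _) = already (won+ w X d X≢)
  -- Here the sum collapses to `∞`, so the move in `G` is no longer available, but Left has already
  -- won.
  winsFirst-+ˡ {𝐋} _ ∞ d (move (left _) _) _ = already (+won 𝐋 _ d λ ())
  winsFirst-+ˡ {𝐋} _ ∞̄ d (move (left _) _) (reply X≢ _) = contradiction refl X≢
  winsFirst-+ˡ {𝐋} G X@(⟨ _ ∣ _ ⟩) d (move (left {Gᴸ = Gᴸ} i) s) t =
    -- Moves in `G` come first in the concatenated options; the lookup lemma identifies the option
    -- reached.
    move (left (i ↑ˡ _)) (subst (WinsSecond 𝐋)
      (sym (lookup-++ˡ (λ i → Gᴸ i + X [ (λ ()) ]) _ i))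
      (winsSecond-+ (Gᴸ i) X (λ ()) s t))
  winsFirst-+ˡ {𝐑} _ ∞ d (move (right _) _) (reply X≢ _) = contradiction refl X≢
  winsFirst-+ˡ {𝐑} _ ∞̄ d (move (right _) _) _ = already (+won 𝐑 _ d λ ())
  winsFirst-+ˡ {𝐑} G X@(⟨ _ ∣ _ ⟩) d (move (right {Gᴿ = Gᴿ} i) s) t =
    move (right (i ↑ˡ _)) (subst (WinsSecond 𝐑)
      (sym (lookup-++ˡ (λ i → Gᴿ i + X [ (λ ()) ]) _ i))
      (winsSecond-+ (Gᴿ i) X (λ ()) s t))

  winsFirst-+ʳ : ∀ {w} G X .(d : ¬ Clash G X) →
                 WinsSecond w G → WinsFirst w X → WinsFirst w (G + X [ d ])
  winsFirst-+ʳ {w} G _ d (reply G≢ _) (already refl) = already (+won w G d G≢)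
  winsFirst-+ʳ {𝐋} ∞ _ d _ (move (left _) _) = already (won+ 𝐋 _ d λ ())
  winsFirst-+ʳ {𝐋} ∞̄ _ d (reply G≢ _) (move (left _) _) = contradiction refl G≢
  winsFirst-+ʳ {𝐋} G@(⟨_∣_⟩ {m} Gᴸ _) X d s (move (left {Gᴸ = Xᴸ} i) t) =
    -- Moves in `X` come after the `suc m` Left moves in `G`.
    move (left (suc m ↑ʳ i)) (subst (WinsSecond 𝐋)
      (sym (lookup-++ʳ (λ i → Gᴸ i + X [ (λ ()) ]) (λ j → G + Xᴸ j [ (λ ()) ]) i))
      (winsSecond-+ G (Xᴸ i) (λ ()) s t))
  winsFirst-+ʳ {𝐑} ∞ _ d (reply G≢ _) (move (right _) _) = contradiction refl G≢
  winsFirst-+ʳ {𝐑} ∞̄ _ d _ (move (right _) _) = already (won+ 𝐑 _ d λ ())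
  winsFirst-+ʳ {𝐑} G@(⟨_∣_⟩ {n = n} _ Gᴿ) X d s (move (right {Gᴿ = Xᴿ} i) t) =
    move (right (suc n ↑ʳ i)) (subst (WinsSecond 𝐑)
      (sym (lookup-++ʳ (λ i → Gᴿ i + X [ (λ ()) ]) (λ j → G + Xᴿ j [ (λ ()) ]) i))
      (winsSecond-+ G (Xᴿ i) (λ ()) s t))

  winsSecond-+ : ∀ {w} G X .(d : ¬ Clash G X) →
                 WinsSecond w G → WinsSecond w X → WinsSecond w (G + X [ d ])
  winsSecond-+ {w} G X d s@(reply G≢ _) t@(reply X≢ _) =
    reply (+≢won (opponent w) G X d G≢ X≢) λ m → winsFirst-after (move-in-+ G X d m) s t

  -- The reply is local: it is taken from the strategy for the summand in which the opponent moved,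
  -- while the other strategy is kept.
  winsFirst-after : ∀ {w G X K} → MoveIn+ (opponent w) G X K →
                    WinsSecond w G → WinsSecond w X → WinsFirst w K
  winsFirst-after {X = X} (inˡ d m) (reply _ f) t = winsFirst-+ˡ _ X d (f m) t
  winsFirst-after {G = G} (inʳ d m) s (reply _ g) = winsFirst-+ʳ G _ d s (g m)

-- When the mover `m` is `w`, the strategy for `G` is one for moving first; otherwise it is one for
-- moving second.
winner-+ˡ : ∀ {w} m G X .(d : ¬ Clash G X) →
            WinsSecond w X → winner m G ≡ w → winner m (G + X [ d ]) ≡ w
winner-+ˡ {𝐋} 𝐋 G X d t p = winsFirst⇒winner (winsFirst-+ˡ G X d (winner⇒winsFirst 𝐋 G p) t)
winner-+ˡ {𝐋} 𝐑 G X d t p = winsSecond⇒winner (winsSecond-+ G X d (winner⇒winsSecond 𝐋 G p) t)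
winner-+ˡ {𝐑} 𝐋 G X d t p = winsSecond⇒winner (winsSecond-+ G X d (winner⇒winsSecond 𝐑 G p) t)
winner-+ˡ {𝐑} 𝐑 G X d t p = winsFirst⇒winner (winsFirst-+ˡ G X d (winner⇒winsFirst 𝐑 G p) t)

winner-+ʳ : ∀ {w} m G X .(d : ¬ Clash G X) →
            WinsSecond w G → winner m X ≡ w → winner m (G + X [ d ]) ≡ w
winner-+ʳ {𝐋} 𝐋 G X d s p = winsFirst⇒winner (winsFirst-+ʳ G X d s (winner⇒winsFirst 𝐋 X p))
winner-+ʳ {𝐋} 𝐑 G X d s p = winsSecond⇒winner (winsSecond-+ G X d s (winner⇒winsSecond 𝐋 X p))
winner-+ʳ {𝐑} 𝐋 G X d s p = winsSecond⇒winner (winsSecond-+ G X d s (winner⇒winsSecond 𝐑 X p))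
winner-+ʳ {𝐑} 𝐑 G X d s p = winsFirst⇒winner (winsFirst-+ʳ G X d s (winner⇒winsFirst 𝐑 X p))

-- Neutrality of zero and comparison with it.

winsSecond-𝟘 : ∀ w → WinsSecond w 𝟘
winsSecond-𝟘 𝐋 = winner⇒winsSecond 𝐋 𝟘 refl
winsSecond-𝟘 𝐑 = winner⇒winsSecond 𝐑 𝟘 refl

nonTerminating-𝟘 : NonTerminating 𝟘
nonTerminating-𝟘 = (λ ()) , (λ ())

o-+-identityˡ : ∀ X .(d : ¬ Clash 𝟘 X) → o (𝟘 + X [ d ]) ≡ o X
-- `refl` sets the player to whoever wins `X` under the given mover; that is possible because both
-- players win `𝟘` moving second.
o-+-identityˡ X d = cong₂ _,_ (winner-+ʳ 𝐋 𝟘 X d (winsSecond-𝟘 _) refl)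
                              (winner-+ʳ 𝐑 𝟘 X d (winsSecond-𝟘 _) refl)

o-+-identityʳ : ∀ G .(d : ¬ Clash G 𝟘) → o (G + 𝟘 [ d ]) ≡ o G
o-+-identityʳ G d = cong₂ _,_ (winner-+ˡ 𝐋 G 𝟘 d (winsSecond-𝟘 _) refl)
                              (winner-+ˡ 𝐑 G 𝟘 d (winsSecond-𝟘 _) refl)

-- Turns the preservation of Left's wins, as `winner-+ʳ` supplies it, into an inequality;
-- `≥ᵂ-from-𝐑` does so for Right's wins.
≥ᵂ-from-𝐋 : ∀ {v w} → (w ≡ 𝐋 → v ≡ 𝐋) → v ≥ᵂ w
≥ᵂ-from-𝐋 {𝐋} {𝐋} _ = ≥-refl
≥ᵂ-from-𝐋 {𝐋} {𝐑} _ = 𝐋≥𝐑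
≥ᵂ-from-𝐋 {𝐑} {𝐋} f = contradiction (sym (f refl)) 𝐋≢𝐑
≥ᵂ-from-𝐋 {𝐑} {𝐑} _ = ≥-refl

≥ᵂ-from-𝐑 : ∀ {v w} → (v ≡ 𝐑 → w ≡ 𝐑) → v ≥ᵂ w
≥ᵂ-from-𝐑 {𝐋} {𝐋} _ = ≥-refl
≥ᵂ-from-𝐑 {𝐋} {𝐑} _ = 𝐋≥𝐑
≥ᵂ-from-𝐑 {𝐑} {𝐋} f = contradiction (f refl) 𝐋≢𝐑
≥ᵂ-from-𝐑 {𝐑} {𝐑} _ = ≥-refl

≥ᵂ𝐋⇒≡𝐋 : ∀ {w} → w ≥ᵂ 𝐋 → w ≡ 𝐋
≥ᵂ𝐋⇒≡𝐋 ≥-refl = refl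

𝐑≥ᵂ⇒≡𝐑 : ∀ {w} → 𝐑 ≥ᵂ w → w ≡ 𝐑
𝐑≥ᵂ⇒≡𝐑 ≥-refl = refl

⩾𝟘⇒oᴿ≡𝐋 : ∀ G → G ⩾ 𝟘 → oᴿ G ≡ 𝐋
-- Testing with `X = 𝟘` suffices: `o (𝟘 + 𝟘)` evaluates to `o 𝟘`, whose second component `𝐋` is
-- maximal.
⩾𝟘⇒oᴿ≡𝐋 G G⩾𝟘 = ≥ᵂ𝐋⇒≡𝐋 (proj₂ (subst (_≥ᴼ o 𝟘)
  (o-+-identityʳ G (defined nonTerminating-𝟘)) (G⩾𝟘 𝟘 nonTerminating-𝟘)))

-- Left wins `G` moving second, so any `X` won by Left stays won by Left after adding `G`, whoever
-- moves first.
oᴿ≡𝐋⇒⩾𝟘 : ∀ G → oᴿ G ≡ 𝐋 → G ⩾ 𝟘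
oᴿ≡𝐋⇒⩾𝟘 G p X nt = subst (o (G + X [ defined nt ]) ≥ᴼ_) (sym (o-+-identityˡ X (defined nt)))
  (≥ᵂ-from-𝐋 (winner-+ʳ 𝐋 G X (defined nt) s) , ≥ᵂ-from-𝐋 (winner-+ʳ 𝐑 G X (defined nt) s))
  where s = winner⇒winsSecond 𝐋 G p

𝟘⩾⇒oᴸ≡𝐑 : ∀ G → 𝟘 ⩾ G → oᴸ G ≡ 𝐑
𝟘⩾⇒oᴸ≡𝐑 G 𝟘⩾G = 𝐑≥ᵂ⇒≡𝐑 (proj₁ (subst (o 𝟘 ≥ᴼ_)
  (o-+-identityʳ G (defined nonTerminating-𝟘)) (𝟘⩾G 𝟘 nonTerminating-𝟘)))

oᴸ≡𝐑⇒𝟘⩾ : ∀ G → oᴸ G ≡ 𝐑 → 𝟘 ⩾ G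
oᴸ≡𝐑⇒𝟘⩾ G p X nt = subst (_≥ᴼ o (G + X [ defined nt ])) (sym (o-+-identityˡ X (defined nt)))
  (≥ᵂ-from-𝐑 (winner-+ʳ 𝐋 G X (defined nt) s) , ≥ᵂ-from-𝐑 (winner-+ʳ 𝐑 G X (defined nt) s))
  where s = winner⇒winsSecond 𝐑 G p

≈𝟘⇒𝒫 : ∀ G → G ≈ 𝟘 → G ∈ 𝒫
≈𝟘⇒𝒫 G G≈𝟘 = trans (sym (o-+-identityʳ G (defined nonTerminating-𝟘))) (G≈𝟘 𝟘 nonTerminating-𝟘)

≥ᵂ-antisym : ∀ {v w} → v ≥ᵂ w → w ≥ᵂ v → v ≡ w
≥ᵂ-antisym ≥-refl _ = refl

⩾-antisym : ∀ {G H} → G ⩾ H → H ⩾ G → G ≈ H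
⩾-antisym G⩾H H⩾G X nt =
  cong₂ _,_ (≥ᵂ-antisym (proj₁ (G⩾H X nt)) (proj₁ (H⩾G X nt)))
            (≥ᵂ-antisym (proj₂ (G⩾H X nt)) (proj₂ (H⩾G X nt)))

≈-sym : ∀ {G H} → G ≈ H → H ≈ G
≈-sym G≈H X nt = sym (G≈H X nt)

corollary15 : (G : Game) → (G > 𝟘 ⇔ G ∈ ℒ) × (G ≈ 𝟘 ⇔ G ∈ 𝒫) × (G ∥ 𝟘 ⇔ G ∈ 𝒩) × (G < 𝟘 ⇔ G ∈ ℛ)
corollary15 G =
    -- If Right won with Left moving first, then `𝟘 ⩾ G` would hold as well, and antisymmetry would
    -- contradict strictness.
    mk⇔ (λ (G⩾𝟘 , G≉𝟘) → cong₂ _,_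
          (≢𝐑⇒≡𝐋 λ p → G≉𝟘 (⩾-antisym {G} {𝟘} G⩾𝟘 (oᴸ≡𝐑⇒𝟘⩾ G p))) (⩾𝟘⇒oᴿ≡𝐋 G G⩾𝟘))
        (λ G∈ℒ → oᴿ≡𝐋⇒⩾𝟘 G (,-injectiveʳ G∈ℒ) ,
          λ G≈𝟘 → 𝐋≢𝐑 (,-injectiveˡ (trans (sym G∈ℒ) (≈𝟘⇒𝒫 G G≈𝟘))))
  , mk⇔ (≈𝟘⇒𝒫 G)
        (λ G∈𝒫 → ⩾-antisym {G} {𝟘} (oᴿ≡𝐋⇒⩾𝟘 G (,-injectiveʳ G∈𝒫)) (oᴸ≡𝐑⇒𝟘⩾ G (,-injectiveˡ G∈𝒫)))
  -- Each failed comparison rules out one value of one component, leaving the other value.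
  , mk⇔ (λ (G⋡𝟘 , 𝟘⋡G) → cong₂ _,_
          (≢𝐑⇒≡𝐋 λ p → 𝟘⋡G (oᴸ≡𝐑⇒𝟘⩾ G p)) (≢𝐋⇒≡𝐑 λ p → G⋡𝟘 (oᴿ≡𝐋⇒⩾𝟘 G p)))
        (λ G∈𝒩 → (λ G⩾𝟘 → 𝐋≢𝐑 (trans (sym (⩾𝟘⇒oᴿ≡𝐋 G G⩾𝟘)) (,-injectiveʳ G∈𝒩))) ,
                 (λ 𝟘⩾G → 𝐋≢𝐑 (trans (sym (,-injectiveˡ G∈𝒩)) (𝟘⩾⇒oᴸ≡𝐑 G 𝟘⩾G))))
  , mk⇔ (λ (𝟘⩾G , 𝟘≉G) → cong₂ _,_ (𝟘⩾⇒oᴸ≡𝐑 G 𝟘⩾G)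
          (≢𝐋⇒≡𝐑 λ p → 𝟘≉G (⩾-antisym {𝟘} {G} 𝟘⩾G (oᴿ≡𝐋⇒⩾𝟘 G p))))
        (λ G∈ℛ → oᴸ≡𝐑⇒𝟘⩾ G (,-injectiveˡ G∈ℛ) ,
          -- Equality would put `G` in `𝒫`, which differs from `ℛ` in the second component.
          λ 𝟘≈G → 𝐋≢𝐑 (,-injectiveʳ (trans (sym (≈𝟘⇒𝒫 G (≈-sym {𝟘} {G} 𝟘≈G))) G∈ℛ)))
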